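{- Let $\mathbf P=(P,\le)$ and $\mathbf Q=(Q,\le)$ be posets, let $(f,f^*)$ be a pair of operator-residuated mappings between $\mathbf P$ and $\mathbf Q$, and let $a\in P$ and $b\in Q$. Then (i) $f(a)\le_1 f\big(f^*(f(a))\big)$ and $f\big(f^*(f(a))\big)\le f(a)$; (ii) $f^*(b)\le_1 f^*\big(f(f^*(b))\big)$ and $f^*\big(f(f^*(b))\big)\le_1 f^*(b)$.
   Context: Singletons are identified with their unique element. For subsets $A,B$ of a poset: $A\le B$ means $x\le y$ for all $x\in A$ and all $y\in B$; $A\le_1 B$ means that for every $x\in A$ there is some $y\in B$ with $x\le y$. An antichain is a subset in which any two different elements are incomparable; $\mathbb A(\mathbf P)$ denotes the set of all non-empty antichains of $\mathbf P$. A pair of operator-residuated mappings between $\mathbf P$ and $\mathbf Q$ is a pair $(f,f^*)$ with $f\colon P\to Q$ and $f^*\colon Q\to\mathbb A(\mathbf P)$ such that for all $x\in P$ and all $y\in Q$: $f(x)\le y$ if and only if $x\le_1 f^*(y)$ (i.e. there is $z\in f^*(y)$ with $x\le z$). The mappings are extended to subsets by unions: for $C\subseteq P$, $f(C):=\{f(x)\mid x\in C\}$, and for $D\subseteq Q$, $f^*(D):=\bigcup_{y\in D}f^*(y)$. -}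

module Defs where

open import Data.Product using (_×_; ∃-syntax)
open import Function using (Func; _⟶ₛ_; _⇔_)
open import Level using (Level; suc; _⊔_)
open import Relation.Binary using (Poset; Setoid; _Respects_)
import Relation.Binary.Construct.On as On
open import Relation.Nullary using (¬_)
open import Relation.Unary using (Pred; _∈_; Satisfiable)
open import Relation.Unary.Relation.Binary.Equality using (≐-setoid)

private
  variable
    c ℓ₁ ℓ₂ c′ ℓ₁′ ℓ₂′ ℓ m : Level

-- Posets carry an equivalence _≈_ as their equality, so singletons and images
-- are taken up to _≈_, and maps into or out of a poset respect it.

singleton : (P : Poset c ℓ₁ ℓ₂) → Poset.Carrier P → Pred (Poset.Carrier P) ℓ₁
singleton P x y = x ≈ y
  where open Poset P

AllBelow : (P : Poset c ℓ₁ ℓ₂) →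
           Pred (Poset.Carrier P) ℓ → Pred (Poset.Carrier P) m → Set (c ⊔ ℓ₂ ⊔ ℓ ⊔ m)
AllBelow P A B = ∀ {x y} → x ∈ A → y ∈ B → x ≤ y
  where open Poset P

EachBelowSome : (P : Poset c ℓ₁ ℓ₂) →
                Pred (Poset.Carrier P) ℓ → Pred (Poset.Carrier P) m → Set (c ⊔ ℓ₂ ⊔ ℓ ⊔ m)
EachBelowSome P A B = ∀ {x} → x ∈ A → ∃[ y ] y ∈ B × x ≤ y
  where open Poset P

infix 4 AllBelow EachBelowSome
syntax singleton P x = ｛ x ｝[ P ]
syntax AllBelow P A B = A ≤[ P ] B
syntax EachBelowSome P A B = A ≤₁[ P ] B

module _ (P : Poset c ℓ₁ ℓ₂) where
  open Poset P

  IsAntichain : Pred Carrier ℓ → Set (c ⊔ ℓ₁ ⊔ ℓ₂ ⊔ ℓ)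
  IsAntichain A = ∀ {x y} → x ∈ A → y ∈ A → ¬ (x ≈ y) → ¬ (x ≤ y) × ¬ (y ≤ x)

  record NonEmptyAntichain (ℓ : Level) : Set (c ⊔ ℓ₁ ⊔ ℓ₂ ⊔ suc ℓ) where
    field
      elements    : Pred Carrier ℓ
      respects    : elements Respects _≈_
      nonEmpty    : Satisfiable elements
      isAntichain : IsAntichain elements

  𝔸 : (ℓ : Level) → Setoid (c ⊔ ℓ₁ ⊔ ℓ₂ ⊔ suc ℓ) (c ⊔ ℓ)
  𝔸 ℓ = On.setoid (≐-setoid Carrier ℓ) (NonEmptyAntichain.elements {ℓ})

record OperatorResiduated (P : Poset c ℓ₁ ℓ₂) (Q : Poset c′ ℓ₁′ ℓ₂′) (ℓ : Level)
  : Set (c ⊔ ℓ₁ ⊔ ℓ₂ ⊔ c′ ⊔ ℓ₁′ ⊔ ℓ₂′ ⊔ suc ℓ) where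
  private
    module P = Poset P
    module Q = Poset Q

  field
    lower : P.Eq.setoid ⟶ₛ Q.Eq.setoid
    upper : Q.Eq.setoid ⟶ₛ 𝔸 P ℓ

  f : P.Carrier → Q.Carrier
  f = Func.to lower

  f* : Q.Carrier → Pred P.Carrier ℓ
  f* y = NonEmptyAntichain.elements (Func.to upper y)

  field
    residuated : ∀ x y → f x Q.≤ y ⇔ ｛ x ｝[ P ] ≤₁[ P ] f* y

  f[_] : Pred P.Carrier m → Pred Q.Carrier (c ⊔ ℓ₁′ ⊔ m)
  f[ C ] y = ∃[ x ] x ∈ C × f x Q.≈ y

  f*[_] : Pred Q.Carrier m → Pred P.Carrier (c′ ⊔ ℓ ⊔ m)
  f*[ D ] x = ∃[ y ] y ∈ D × x ∈ f* y

{-# OPTIONS --safe #-}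
module Submission where

open import Defs
open import Data.Product using (_×_; _,_; ∃-syntax)
open import Function using (Equivalence)
open import Level using (Level)
open import Relation.Binary using (Poset)
open import Relation.Unary using (_∈_)

-- As for a Galois connection, residuation yields a unit `≤₁f*f` (from `f x ≤ f x`) and a counit
-- `∈f*⇒f≤` (from `x ≤ x`), hence monotonicity of `f`. Part (i) is `f` applied to the unit, and the
-- counit at `f a`. Part (ii) is the unit at each element of `f* b`, and two counits chained, then
-- transposed.

module _ {c ℓ₁ ℓ₂ c′ ℓ₁′ ℓ₂′ ℓ : Level}
  {P : Poset c ℓ₁ ℓ₂} {Q : Poset c′ ℓ₁′ ℓ₂′} (r : OperatorResiduated P Q ℓ) where
  private
    module P = Poset P
    module Q = Poset Q
  open OperatorResiduated r

  f≤⇒≤₁f* : ∀ {x y} → f x Q.≤ y → ∃[ z ] z ∈ f* y × x P.≤ z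
  f≤⇒≤₁f* {x} {y} fx≤y = Equivalence.to (residuated x y) fx≤y P.Eq.refl

  -- Singletons are closed under `≈`, so the one bound `z` must serve every `x′ ≈ x`.
  ≤∈f*⇒f≤ : ∀ {x y z} → x P.≤ z → z ∈ f* y → f x Q.≤ y
  ≤∈f*⇒f≤ {x} {y} {z} x≤z z∈f*y = Equivalence.from (residuated x y)
    λ x≈x′ → z , z∈f*y , P.trans (P.reflexive (P.Eq.sym x≈x′)) x≤z

  ∈f*⇒f≤ : ∀ {x y} → x ∈ f* y → f x Q.≤ y
  ∈f*⇒f≤ = ≤∈f*⇒f≤ P.refl

  ≤₁f*f : ∀ x → ∃[ z ] z ∈ f* (f x) × x P.≤ z
  ≤₁f*f x = f≤⇒≤₁f* Q.refl

  -- The unit places `x′`, hence also `x`, below some element of `f* (f x′)`; transposing back gives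
  -- the claim.
  f-mono : ∀ {x x′} → x P.≤ x′ → f x Q.≤ f x′
  f-mono {x′ = x′} x≤x′ with ≤₁f*f x′
  ... | z , z∈ , x′≤z = ≤∈f*⇒f≤ (P.trans x≤x′ x′≤z) z∈

theorem2p6 : ∀ {c ℓ₁ ℓ₂ c′ ℓ₁′ ℓ₂′ ℓ : Level}
    (P : Poset c ℓ₁ ℓ₂) (Q : Poset c′ ℓ₁′ ℓ₂′) (r : OperatorResiduated P Q ℓ)
    (a : Poset.Carrier P) (b : Poset.Carrier Q) →
    let open OperatorResiduated r in
    ((｛ f a ｝[ Q ] ≤₁[ Q ] f[ f* (f a) ]) × (f[ f* (f a) ] ≤[ Q ] ｛ f a ｝[ Q ]))
    × ((f* b ≤₁[ P ] f*[ f[ f* b ] ]) × (f*[ f[ f* b ] ] ≤₁[ P ] f* b))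
theorem2p6 P Q r a b = (fa≤₁ff*fa , ff*fa≤fa) , (f*b≤₁f*ff*b , f*ff*b≤₁f*b)
  where
  module Q = Poset Q
  open OperatorResiduated r

  fa≤₁ff*fa : ｛ f a ｝[ Q ] ≤₁[ Q ] f[ f* (f a) ]
  fa≤₁ff*fa fa≈y with ≤₁f*f r a
  ... | z , z∈ , a≤z =
    f z , (z , z∈ , Q.Eq.refl) , Q.trans (Q.reflexive (Q.Eq.sym fa≈y)) (f-mono r a≤z)

  ff*fa≤fa : f[ f* (f a) ] ≤[ Q ] ｛ f a ｝[ Q ]
  ff*fa≤fa (_ , z∈ , fz≈x) fa≈y =
    Q.trans (Q.reflexive (Q.Eq.sym fz≈x)) (Q.trans (∈f*⇒f≤ r z∈) (Q.reflexive fa≈y))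

  f*b≤₁f*ff*b : f* b ≤₁[ P ] f*[ f[ f* b ] ]
  f*b≤₁f*ff*b {x} x∈ with ≤₁f*f r x
  -- The unit's bound `z` lies in the union through the index `f x`.
  ... | z , z∈ , x≤z = z , (f x , (x , x∈ , Q.Eq.refl) , z∈) , x≤z

  f*ff*b≤₁f*b : f*[ f[ f* b ] ] ≤₁[ P ] f* b
  f*ff*b≤₁f*b (_ , (_ , z∈ , fz≈y) , x∈) =
    -- With `x ∈ f* y`, `y ≈ f z` and `z ∈ f* b`: `f x ≤ y ≈ f z ≤ b`.
    f≤⇒≤₁f* r (Q.trans (∈f*⇒f≤ r x∈) (Q.trans (Q.reflexive (Q.Eq.sym fz≈y)) (∈f*⇒f≤ r z∈)))
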